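{- For $n\ge1$ and $1\le k\le 2n-1$ let $a_n(k):=\#\mathfrak A_{2n-1,k-1}$ and $b_n(k):=\#\mathfrak A_{2n,k}$. Then both families $(a_n(k))$ and $(b_n(k))$ satisfy the finite difference system $$f_n(k+2)-2f_n(k+1)+f_n(k)+4\,f_{n-1}(k)=0\qquad (n\ge 2,\ 1\le k\le 2n-3),$$ and moreover $a_1(1)=1$, $a_n(1)=a_n(2n-1)=0$ for $n\ge2$, while $b_1(1)=1$, $b_n(1)=b_n(2n-1)=\sum_k b_{n-1}(k)$ for $n\ge 2$. In other words, $(a_n(k))$ (resp. $(b_n(k))$) is the solution of the system with initial values $f_1(1)=1$, $f_n(1)=f_n(2n-1)=0$ $(n\ge2)$ (resp. $f_1(1)=1$, $f_n(1)=f_n(2n-1)=\sum_kf_{n-1}(k)$ $(n\ge2)$).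
   Context: A permutation $\sigma=\sigma(1)\cdots\sigma(n)$ of $\{1,\dots,n\}$ is alternating if $\sigma(1)>\sigma(2)<\sigma(3)>\sigma(4)<\cdots$. $\mathfrak A_n$ is the set of alternating permutations of $\{1,\dots,n\}$. For $\sigma\in\mathfrak A_n$ with $\sigma(i)=n$, set $\sigma(0)=\sigma(n+1):=0$ and $\mathrm{grn}(\sigma):=\max\{\sigma(i-1),\sigma(i+1)\}$. $\mathfrak A_{n,k}:=\{\sigma\in\mathfrak A_n:\mathrm{grn}(\sigma)=k\}$. -}

module Defs where

open import Data.Nat using (ℕ; zero; suc; _+_; _*_; _∸_; _<ᵇ_; _≡ᵇ_; _⊔_)
open import Data.Bool using (Bool; true; false; _∧_; not)
open import Data.List using (List; []; _∷_; length; filter; map; concatMap; applyUpTo)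
open import Data.Nat.ListAction using (sum)
open import Data.Bool.ListAction using (any)
open import Relation.Nullary.Decidable using (Dec; yes; no)
open import Data.Bool.Properties using () renaming (_≟_ to _≟b_)

words : ℕ → ℕ → List (List ℕ)
words zero    n = [] ∷ []
words (suc m) n = concatMap (λ w → applyUpTo (λ i → suc i ∷ w) n) (words m n)

distinct : List ℕ → Bool
distinct []       = true
distinct (x ∷ xs) = not (any (λ y → x ≡ᵇ y) xs) ∧ distinct xs

-- a word of length n with entries in {1..n} is a permutation iff entries are distinct
isPerm : List ℕ → Bool
isPerm = distinct

mutual
  altDown : List ℕ → Bool
  altDown (x ∷ y ∷ r) = (y <ᵇ x) ∧ altUp (y ∷ r)
  altDown _           = true
  altUp : List ℕ → Bool
  altUp (x ∷ y ∷ r) = (x <ᵇ y) ∧ altDown (y ∷ r)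
  altUp _           = true

isAlternating : List ℕ → Bool
isAlternating = altDown

headOr0 : List ℕ → ℕ
headOr0 []      = 0
headOr0 (x ∷ _) = x

-- grn: with σ(0)=σ(n+1)=0, the larger neighbour of the entry n
grnAux : ℕ → ℕ → List ℕ → ℕ
grnAux n prev []       = 0
grnAux n prev (x ∷ xs) with x ≡ᵇ n
... | true  = prev ⊔ headOr0 xs
... | false = grnAux n x xs

grn : ℕ → List ℕ → ℕ
grn n σ = grnAux n 0 σ

𝔄 : ℕ → ℕ → List (List ℕ)
𝔄 n k = filter (λ σ → (isPerm σ ∧ isAlternating σ ∧ (grn n σ ≡ᵇ k)) ≟b true) (words n n)

#𝔄 : ℕ → ℕ → ℕ
#𝔄 n k = length (𝔄 n k)

aₙ : ℕ → ℕ → ℕ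
aₙ n k = #𝔄 (2 * n ∸ 1) (k ∸ 1)

bₙ : ℕ → ℕ → ℕ
bₙ n k = #𝔄 (2 * n) k

sum1to : ℕ → (ℕ → ℕ) → ℕ
sum1to m f = sum (applyUpTo (λ i → f (suc i)) m)

-- Build an alternating permutation of 1, …, N by inserting 1, …, N − 1 in increasing order into a word whose unfilled
-- peaks are blanks, written 0 and considered larger than every letter; start with one blank (N odd) or with the empty
-- word (N even). A new letter m, larger than all earlier ones, either fills a blank or is a new valley, in which case
-- "0 m" is inserted before a blank or, for N even, at the end of the word. With c blanks and e = 1 (N even) or
-- e = 0 (N odd), the number of completions is governed by
--   (T f)(c) = c f(c − 1) + (c + e) f(c + 1).
-- The greater neighbour of N is k iff N takes a blank next to the valley k at the moment when k is inserted. This can be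
-- done in M = 2c + e ways, and from then on N plays no role. So #𝔄 N k is the value at c = 1 − e of
-- T^(k−1) M T^(N−1−k) [c = 0], and the difference system is the relation [T,[T,M]] = −4 M.
module Submission where

open import Defs
open import Data.Bool using (true; false; _∧_)
open import Data.Bool.Properties using (∧-conicalˡ; ∧-conicalʳ; T-≡)
open import Data.Bool.ListAction using (any)
open import Data.Nat
open import Data.Nat.Properties
open import Data.Nat.ListAction using (sum)
open import Data.Nat.ListAction.Properties using (sum-++)
open import Data.Nat.Tactic.RingSolver using (solve-∀)
open import Data.List using (List; []; _∷_; _++_; applyUpTo; concatMap; filter; length; map)
open import Data.List.Properties
  using (map-++; map-∘; length-++; ∷-injectiveˡ; ∷-injectiveʳ; length-applyUpTo)
open import Data.List.Membership.Propositional using (_∈_; find; lose)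
open import Data.List.Membership.Propositional.Properties
open import Data.List.Membership.DecPropositional _≟_ using (_∈?_)
open import Data.List.Relation.Binary.Subset.Propositional using (_⊆_)
open import Data.List.Relation.Unary.All as All using (All; []; _∷_)
import Data.List.Relation.Unary.All.Properties as All
open import Data.List.Relation.Unary.AllPairs using ([]; _∷_)
open import Data.List.Relation.Unary.Any using (here; there)
open import Data.List.Relation.Unary.Unique.Propositional using (Unique)
import Data.List.Relation.Unary.Unique.Propositional.Properties as Unique
open import Data.Product using (∃; ∃₂; _×_; _,_; proj₁; proj₂)
open import Data.Sum as Sum using (_⊎_; inj₁; inj₂)
open import Function using (_∘_; case_of_)
open import Function.Bundles using (module Equivalence)
open import Relation.Nullary using (¬_; yes; no; contradiction)
open import Relation.Binary.PropositionalEquality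
open ≡-Reasoning

-- The transfer operator and its commutation relations.

transfer : ℕ → (ℕ → ℕ) → ℕ → ℕ
transfer e f c = c * f (pred c) + (c + e) * f (suc c)

-- The number of ways to insert t more letters into a word with c blanks so that no blank remains.
φ : ℕ → ℕ → ℕ → ℕ
φ e zero    zero    = 1
φ e zero    (suc c) = 0
φ e (suc t) c       = transfer e (φ e t) c

-- `ψ e s t` is T^s M T^t applied to the indicator of 0.
ψ : ℕ → ℕ → ℕ → ℕ → ℕ
ψ e zero    t c = (c + c + e) * φ e t c
ψ e (suc s) t c = transfer e (ψ e s t) c

transfer-cong : ∀ e {f g} → (∀ c → f c ≡ g c) → ∀ c → transfer e f c ≡ transfer e g c
transfer-cong e f≗g c = cong₂ (λ a b → c * a + (c + e) * b) (f≗g (pred c)) (f≗g (suc c))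

-- The relation [T,[T,M]] = −4 M for M = 2c + e, moved to ℕ.
ψ-difference : ∀ e s t c →
  ψ e (2 + s) t c + ψ e s (2 + t) c + 4 * ψ e s t c ≡ 2 * ψ e (1 + s) (1 + t) c
-- Two applications of T reach down to c - 2, so the truncated `pred` makes c = 0 and c = 1 separate
-- cases.
ψ-difference e zero t zero = lemma e (φ e t 0) (φ e t 2)
  where
  lemma : ∀ e f₀ f₂ →
    e * (1 * (e * f₀) + (1 + e) * ((4 + e) * f₂)) + e * (e * (1 * f₀ + (1 + e) * f₂)) + 4 * (e * f₀)
    ≡ 2 * (e * ((2 + e) * (1 * f₀ + (1 + e) * f₂)))
  lemma = solve-∀
ψ-difference e zero t (suc zero) = lemma e (φ e t 1) (φ e t 3)
  where
  lemma : ∀ e f₁ f₃ →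
    1 * (e * ((2 + e) * f₁)) + (1 + e) * (2 * ((2 + e) * f₁) + (2 + e) * ((6 + e) * f₃))
    + (2 + e) * (1 * (e * f₁) + (1 + e) * (2 * f₁ + (2 + e) * f₃)) + 4 * ((2 + e) * f₁)
    ≡ 2 * (1 * (e * (e * f₁)) + (1 + e) * ((4 + e) * (2 * f₁ + (2 + e) * f₃)))
  lemma = solve-∀
ψ-difference e zero t (suc (suc d)) = lemma e d (φ e t d) (φ e t (2 + d)) (φ e t (4 + d))
  where
  lemma : ∀ e d f₀ f₂ f₄ →
    let M = λ c → c + c + e
        T = λ c x y → c * x + (c + e) * y in
    T (2 + d) (T (1 + d) (M d * f₀) (M (2 + d) * f₂)) (T (3 + d) (M (2 + d) * f₂) (M (4 + d) * f₄))
    + M (2 + d) * T (2 + d) (T (1 + d) f₀ f₂) (T (3 + d) f₂ f₄) + 4 * (M (2 + d) * f₂)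
    ≡ 2 * T (2 + d) (M (1 + d) * T (1 + d) f₀ f₂) (M (3 + d) * T (3 + d) f₂ f₄)
  lemma = solve-∀
-- T is linear, so applying it to the relation for `s` gives the relation for `suc s`.
ψ-difference e (suc s) t c = begin
  transfer e (ψ e (2 + s) t) c + transfer e (ψ e s (2 + t)) c + 4 * transfer e (ψ e s t) c
    ≡⟨ linear e c _ _ _ _ _ _ ⟩
  transfer e (λ d → ψ e (2 + s) t d + ψ e s (2 + t) d + 4 * ψ e s t d) c
    ≡⟨ transfer-cong e (ψ-difference e s t) c ⟩
  transfer e (λ d → 2 * ψ e (1 + s) (1 + t) d) c
    ≡⟨ scale e c _ _ ⟩
  2 * transfer e (ψ e (1 + s) (1 + t)) c ∎
  where
  linear : ∀ e c f g h f′ g′ h′ →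
    (c * f + (c + e) * f′) + (c * g + (c + e) * g′) + 4 * (c * h + (c + e) * h′)
    ≡ c * (f + g + 4 * h) + (c + e) * (f′ + g′ + 4 * h′)
  linear = solve-∀
  scale : ∀ e c f f′ → c * (2 * f) + (c + e) * (2 * f′) ≡ 2 * (c * f + (c + e) * f′)
  scale = solve-∀

transfer-+ : ∀ e f g c → transfer e f c + transfer e g c ≡ transfer e (λ d → f d + g d) c
transfer-+ e f g c = lemma e c (f (pred c)) (f (suc c)) (g (pred c)) (g (suc c))
  where
  lemma : ∀ e c x y z w → (c * x + (c + e) * y) + (c * z + (c + e) * w) ≡ c * (x + z) + (c + e) * (y + w)
  lemma = solve-∀

transfer-sum : ∀ e (g : ℕ → ℕ → ℕ) n c →
  sum (applyUpTo (λ i → transfer e (g i) c) n) ≡ transfer e (λ d → sum (applyUpTo (λ i → g i d) n)) c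
transfer-sum e g zero    c = sym (cong₂ _+_ (*-zeroʳ c) (*-zeroʳ (c + e)))
transfer-sum e g (suc n) c =
  trans (cong (transfer e (g 0) c +_) (transfer-sum e (λ i → g (suc i)) n c))
        (transfer-+ e (g 0) (λ d → sum (applyUpTo (λ i → g (suc i) d) n)) c)

-- With D f (c) = c f(c - 1) this is M = [T,D]; the product D T stands on the left to avoid
-- subtraction.
transfer-commutator : ∀ e f c →
  (c + c + e) * f c + c * transfer e f (pred c) ≡ transfer e (λ d → d * f (pred d)) c
transfer-commutator e f zero    = lemma e (f 0)
  where
  lemma : ∀ e x → e * x + 0 ≡ e * (1 * x)
  lemma = solve-∀
transfer-commutator e f (suc c) = lemma e c (f (pred c)) (f (suc c))
  where
  lemma : ∀ e c x y → (1 + c + (1 + c) + e) * y + (1 + c) * (c * x + (c + e) * y)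
                      ≡ (1 + c) * (c * x) + (1 + c + e) * ((2 + c) * y)
  lemma = solve-∀

-- With D f c = c f(c − 1) one has M = [T,D], so the sum of the Tⁱ M Tⁿ⁻ⁱ telescopes.
ψ-sum : ∀ e n c →
  sum (applyUpTo (λ i → ψ e i (n ∸ i) c) (suc n)) + c * φ e (suc n) (pred c) ≡ φ e (2 + n) c
ψ-sum e zero c = begin
  (c + c + e) * φ e 0 c + 0 + c * φ e 1 (pred c)   ≡⟨ cong (_+ c * φ e 1 (pred c)) (+-identityʳ _) ⟩
  (c + c + e) * φ e 0 c + c * φ e 1 (pred c)       ≡⟨ transfer-commutator e (φ e 0) c ⟩
  transfer e (λ d → d * φ e 0 (pred d)) c          ≡⟨ transfer-cong e drop-zero c ⟩
  φ e 2 c                                          ∎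
  where
  -- The indicator of 0 vanishes at `suc d`, so T acts on it as D does.
  drop-zero : ∀ d → d * φ e 0 (pred d) ≡ φ e 1 d
  drop-zero d = sym (trans (cong (d * φ e 0 (pred d) +_) (*-zeroʳ (d + e))) (+-identityʳ _))
ψ-sum e (suc n) c = begin
  M + sum (applyUpTo (λ i → transfer e (ψ e i (n ∸ i)) c) (suc n)) + X
    -- All summands but the first begin with T, which is pulled out of the sum.
    ≡⟨ cong (λ z → M + z + X) (transfer-sum e (λ i → ψ e i (n ∸ i)) (suc n) c) ⟩
  M + transfer e S c + X
    ≡⟨ cong (_+ X) (+-comm M _) ⟩
  transfer e S c + M + X
    ≡⟨ +-assoc (transfer e S c) M X ⟩
  transfer e S c + (M + X)
    ≡⟨ cong (transfer e S c +_) (transfer-commutator e (φ e (suc n)) c) ⟩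
  transfer e S c + transfer e (λ d → d * φ e (suc n) (pred d)) c
    ≡⟨ transfer-+ e S (λ d → d * φ e (suc n) (pred d)) c ⟩
  transfer e (λ d → S d + d * φ e (suc n) (pred d)) c
    ≡⟨ transfer-cong e (ψ-sum e n) c ⟩
  φ e (3 + n) c ∎
  where
  M = (c + c + e) * φ e (suc n) c
  X = c * φ e (2 + n) (pred c)
  S = λ d → sum (applyUpTo (λ i → ψ e i (n ∸ i) d) (suc n))

-- Duplicate-free lists and their lengths.

private variable
  X Y : Set

module _ (f : X → List Y) where

  ∈-concatMap⇒ : ∀ xs {y} → y ∈ concatMap f xs → ∃ λ x → x ∈ xs × y ∈ f x
  ∈-concatMap⇒ xs y∈ = find (∈-concatMap⁻ f {xs = xs} y∈)

  ⇒∈-concatMap : ∀ {xs x y} → x ∈ xs → y ∈ f x → y ∈ concatMap f xs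
  ⇒∈-concatMap x∈ y∈ = ∈-concatMap⁺ f (lose x∈ y∈)

  -- `g` recovers from an element the entry that produced it, so the lists produced by different
  -- entries are disjoint.
  concatMap-unique : ∀ (g : Y → X) xs → Unique xs → (∀ {x} → x ∈ xs → Unique (f x)) →
                     (∀ {x y} → x ∈ xs → y ∈ f x → g y ≡ x) → Unique (concatMap f xs)
  concatMap-unique g []       _          _  _   = []
  concatMap-unique g (x ∷ xs) (x∉ ∷ xs!) f! inv =
    Unique.++⁺ (f! (here refl)) (concatMap-unique g xs xs! (f! ∘ there) (inv ∘ there)) disjoint
    where
    disjoint : ∀ {y} → ¬ (y ∈ f x × y ∈ concatMap f xs)
    disjoint (y∈fx , y∈rest) with z , z∈ , y∈fz ← ∈-concatMap⇒ xs y∈rest =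
      All.lookup x∉ z∈ (trans (sym (inv (here refl) y∈fx)) (inv (there z∈) y∈fz))

∈-remove : ∀ {x z : X} ys {zs} → z ∈ ys ++ x ∷ zs → x ≢ z → z ∈ ys ++ zs
∈-remove ys z∈ x≢z with ∈-++⁻ ys z∈
... | inj₁ p         = ∈-++⁺ˡ p
... | inj₂ (here eq) = contradiction (sym eq) x≢z
... | inj₂ (there p) = ∈-++⁺ʳ ys p

-- Cut the first entry of `xs` out of `ys`: it does not recur in `xs`, so the remaining entries
-- still lie in what is left.
unique-⊆⇒length≤ : {xs ys : List X} → Unique xs → xs ⊆ ys → length xs ≤ length ys
unique-⊆⇒length≤ []        _  = z≤n
unique-⊆⇒length≤ {xs = x ∷ xs} (x∉ ∷ xs!) xs⊆ with us , vs , refl ← ∈-∃++ (xs⊆ (here refl)) =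
  subst (suc (length xs) ≤_) (sym eq)
    (s≤s (unique-⊆⇒length≤ xs! λ z∈ → ∈-remove us (xs⊆ (there z∈)) (All.lookup x∉ z∈)))
  where
  eq : length (us ++ x ∷ vs) ≡ suc (length (us ++ vs))
  eq = trans (length-++ us) (trans (+-suc _ _) (cong suc (sym (length-++ us))))

unique-⊆⊇⇒length≡ : {xs ys : List X} → Unique xs → Unique ys → xs ⊆ ys → ys ⊆ xs → length xs ≡ length ys
unique-⊆⊇⇒length≡ xs! ys! p q = ≤-antisym (unique-⊆⇒length≤ xs! p) (unique-⊆⇒length≤ ys! q)

-- An entry of `ys` missing from `xs` could be put in front of `xs`, and the longer list would not
-- fit into `ys`.
unique-⊆-length≥⇒⊇ : ∀ {xs ys} → Unique xs → xs ⊆ ys → length ys ≤ length xs → ys ⊆ xs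
unique-⊆-length≥⇒⊇ {xs} {ys} xs! xs⊆ len {y} y∈ with y ∈? xs
... | yes y∈xs = y∈xs
... | no  y∉xs = contradiction (unique-⊆⇒length≤ (All.tabulate fresh ∷ xs!) y∷xs⊆) (<⇒≱ (s≤s len))
  where
  fresh : ∀ {x} → x ∈ xs → y ≢ x
  fresh x∈ refl = y∉xs x∈
  y∷xs⊆ : (y ∷ xs) ⊆ ys
  y∷xs⊆ (here refl) = y∈
  y∷xs⊆ (there p)   = xs⊆ p

-- Multiplicities of letters.

δ : ℕ → ℕ → ℕ
δ zero    zero    = 1
δ zero    (suc x) = 0
δ (suc j) zero    = 0
δ (suc j) (suc x) = δ j x

δ-refl : ∀ j → δ j j ≡ 1
δ-refl zero    = refl
δ-refl (suc j) = δ-refl j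

δ-≢ : ∀ {j x} → j ≢ x → δ j x ≡ 0
δ-≢ {zero}  {zero}  j≢x = contradiction refl j≢x
δ-≢ {zero}  {suc x} j≢x = refl
δ-≢ {suc j} {zero}  j≢x = refl
δ-≢ {suc j} {suc x} j≢x = δ-≢ (j≢x ∘ cong suc)

δ≤1 : ∀ j x → δ j x ≤ 1
δ≤1 j x with j ≟ x
... | yes refl = ≤-reflexive (δ-refl j)
... | no  j≢x  = subst (_≤ 1) (sym (δ-≢ j≢x)) z≤n

occ : ℕ → List ℕ → ℕ
occ j []       = 0
occ j (x ∷ xs) = δ j x + occ j xs

∈⇒occ>0 : ∀ {j xs} → j ∈ xs → 0 < occ j xs
∈⇒occ>0 {j} (here refl)    = ≤-trans (≤-reflexive (sym (δ-refl j))) (m≤m+n _ _)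
∈⇒occ>0 {j} (there {x} j∈) = ≤-trans (∈⇒occ>0 j∈) (m≤n+m _ (δ j x))

occ>0⇒∈ : ∀ {j} xs → 0 < occ j xs → j ∈ xs
occ>0⇒∈ {j} (x ∷ xs) o with j ≟ x
... | yes refl = here refl
... | no  j≢x  = there (occ>0⇒∈ xs (subst (λ d → 0 < d + occ j xs) (δ-≢ j≢x) o))

occ≡0⇒≢ : ∀ {j xs} → occ j xs ≡ 0 → All (_≢ j) xs
occ≡0⇒≢ o = All.tabulate λ { x∈ refl → <⇒≢ (∈⇒occ>0 x∈) (sym o) }

occ≤1⇒unique : ∀ xs → (∀ j → occ j xs ≤ 1) → Unique xs
occ≤1⇒unique []       _ = []
occ≤1⇒unique (x ∷ xs) o =
  All.map (_∘ sym) (occ≡0⇒≢ x∉) ∷ occ≤1⇒unique xs (λ j → ≤-trans (m≤n+m _ (δ j x)) (o j))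
  where
  x∉ : occ x xs ≡ 0
  x∉ = n≤0⇒n≡0 (≤-pred (subst (λ d → d + occ x xs ≤ 1) (δ-refl x) (o x)))

unique⇒occ≤1 : ∀ {xs} j → Unique xs → occ j xs ≤ 1
unique⇒occ≤1 j []         = z≤n
unique⇒occ≤1 {x ∷ xs} j (x∉ ∷ xs!) with j ≟ x
... | no  j≢x  = subst (λ d → d + occ j xs ≤ 1) (sym (δ-≢ j≢x)) (unique⇒occ≤1 j xs!)
... | yes refl with occ j xs in eq
...   | zero  = ≤-trans (≤-reflexive (+-identityʳ _)) (δ≤1 j j)
...   | suc _ = contradiction refl (All.lookup x∉ (occ>0⇒∈ xs (subst (0 <_) (sym eq) z<s)))

-- Boolean tests and the propositions they decide.

≡ᵇ-refl : ∀ n → (n ≡ᵇ n) ≡ true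
≡ᵇ-refl zero    = refl
≡ᵇ-refl (suc n) = ≡ᵇ-refl n

≢⇒≡ᵇ-false : ∀ {m n} → m ≢ n → (m ≡ᵇ n) ≡ false
≢⇒≡ᵇ-false {zero}  {zero}  p = contradiction refl p
≢⇒≡ᵇ-false {zero}  {suc n} p = refl
≢⇒≡ᵇ-false {suc m} {zero}  p = refl
≢⇒≡ᵇ-false {suc m} {suc n} p = ≢⇒≡ᵇ-false (p ∘ cong suc)

any-false⇒≢ : ∀ {x} ys → any (λ y → x ≡ᵇ y) ys ≡ false → All (x ≢_) ys
any-false⇒≢         []       _ = []
any-false⇒≢ {x} (y ∷ ys) a with x ≡ᵇ y in eq
any-false⇒≢ {x} (y ∷ ys) a | false =
  (λ { refl → case trans (sym eq) (≡ᵇ-refl x) of λ () }) ∷ any-false⇒≢ ys a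
any-false⇒≢ {x} (y ∷ ys) () | true

≢⇒any-false : ∀ {x ys} → All (x ≢_) ys → any (λ y → x ≡ᵇ y) ys ≡ false
≢⇒any-false []       = refl
≢⇒any-false (p ∷ ps) rewrite ≢⇒≡ᵇ-false p = ≢⇒any-false ps

distinct⇒unique : ∀ xs → distinct xs ≡ true → Unique xs
distinct⇒unique []       _ = []
distinct⇒unique (x ∷ xs) d with any (λ y → x ≡ᵇ y) xs in eq
distinct⇒unique (x ∷ xs) d  | false = any-false⇒≢ xs eq ∷ distinct⇒unique xs d
distinct⇒unique (x ∷ xs) () | true

unique⇒distinct : ∀ {xs} → Unique xs → distinct xs ≡ true
unique⇒distinct []         = refl
unique⇒distinct (x∉ ∷ xs!) rewrite ≢⇒any-false x∉ = unique⇒distinct xs!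

-- Words over the letters 1, ..., n.

Letter : ℕ → ℕ → Set
Letter n x = 0 < x × x ≤ n

∈-words⁻ : ∀ m n {w} → w ∈ words m n → length w ≡ m × All (Letter n) w
∈-words⁻ zero    n (here refl) = refl , []
∈-words⁻ (suc m) n w∈ with v , v∈ , w∈fv ← ∈-concatMap⇒ _ (words m n) w∈
                      with i , i<n , refl ← ∈-applyUpTo⁻ (λ i → suc i ∷ v) w∈fv
                      with len , ls ← ∈-words⁻ m n v∈ = cong suc len , (z<s , i<n) ∷ ls

∈-words⁺ : ∀ {n w} → All (Letter n) w → w ∈ words (length w) n
∈-words⁺ []                            = here refl
∈-words⁺ {w = suc i ∷ v} ((_ , i<n) ∷ ls) =
  ⇒∈-concatMap _ (∈-words⁺ ls) (∈-applyUpTo⁺ (λ i → suc i ∷ v) i<n)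

words-unique : ∀ m n → Unique (words m n)
words-unique zero    n = [] ∷ []
words-unique (suc m) n =
  -- The tail recovers the word that was extended.
  concatMap-unique _ (λ { [] → [] ; (_ ∷ v) → v }) (words m n) (words-unique m n)
    (λ {v} _ → Unique.applyUpTo⁺₁ (λ i → suc i ∷ v) n
      (λ i<j _ eq → <⇒≢ i<j (suc-injective (∷-injectiveˡ eq))))
    (λ {v} _ y∈ → case ∈-applyUpTo⁻ (λ i → suc i ∷ v) y∈ of λ { (_ , _ , refl) → refl })

-- Alternating words with blanks.

infix 4 _≺_

-- The letter 0 is a blank, i.e. a peak larger than all letters.
data _≺_ (p : ℕ) : ℕ → Set where
  blank  : p ≺ 0
  letter : ∀ {x} → p ≤ x → p ≺ suc x

-- Peaks and valleys alternate, starting with a peak; p is the valley before the word and b bounds the valleys.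
data Alt (b : ℕ) (p : ℕ) : List ℕ → Set where
  []   : Alt b p []
  one  : ∀ {x} → p ≺ x → Alt b p (x ∷ [])
  step : ∀ {x y r} → p ≺ x → y < b → suc y ≺ x → Alt b (suc y) r → Alt b p (x ∷ suc y ∷ r)

Alt-raise : ∀ {b p w} → Alt b p w → Alt (suc b) p w
Alt-raise []               = []
Alt-raise (one p≺x)        = one p≺x
Alt-raise (step p≺x y<b y≺x a) = step p≺x (m<n⇒m<1+n y<b) y≺x (Alt-raise a)

-- A valley excluded by the sharper bound would be the letter `suc b` itself, which does not occur.
Alt-lower : ∀ {b p w} → Alt (suc b) p w → occ (suc b) w ≡ 0 → Alt b p w
Alt-lower []        _ = []
Alt-lower (one p≺x) _ = one p≺x
Alt-lower {b} (step {x} {y} {r} p≺x y≤b y≺x a) o =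
  step p≺x (≤∧≢⇒< (≤-pred y≤b) λ { refl → case trans (sym (δ-refl y)) (m+n≡0⇒m≡0 _ o′) of λ () })
       y≺x (Alt-lower a (m+n≡0⇒n≡0 (δ b y) o′))
  where
  o′ : δ b y + occ (suc b) r ≡ 0
  o′ = m+n≡0⇒n≡0 (δ (suc b) x) o

-- A blank exceeds every letter, so the valleys next to it impose no condition; hence the free
-- change from `q` to `p`.
Alt-blank : ∀ {b p q z v} → Alt b q (z ∷ v) → Alt b p (0 ∷ v)
Alt-blank (one _)        = one blank
Alt-blank (step _ y<b _ a) = step blank y<b blank a

Alt-head : ∀ {b p z v} → Alt b p (z ∷ v) → p ≺ z
Alt-head (one p≺z)        = p≺z
Alt-head (step p≺z _ _ _) = p≺z

-- Insertion of the next letter.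

even : ℕ → ℕ
even zero          = 1
even (suc zero)    = 0
even (suc (suc n)) = even n

even≤1 : ∀ m → even m ≤ 1
even≤1 zero          = ≤-refl
even≤1 (suc zero)    = z≤n
even≤1 (suc (suc m)) = even≤1 m

start : ℕ → List ℕ
start zero    = 0 ∷ []
start (suc _) = []

-- Only peak positions are inspected, two letters at a time, so that the recursion runs parallel to
-- `insertions`.
blanks : List ℕ → ℕ
blanks []              = 0
blanks (zero  ∷ [])    = 1
blanks (suc x ∷ [])    = 0
blanks (zero  ∷ y ∷ r) = suc (blanks r)
blanks (suc x ∷ y ∷ r) = blanks r

-- The new letter suc m is a peak in the case fill and a valley in the cases end and ins.
data Ins (m : ℕ) : List ℕ → List ℕ → Set where
  end  : Ins m [] (0 ∷ suc m ∷ [])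
  fill : ∀ {v} → Ins m (0 ∷ v) (suc m ∷ v)
  ins  : ∀ {v} → Ins m (0 ∷ v) (0 ∷ suc m ∷ 0 ∷ v)
  next : ∀ {x y w w′} → Ins m w w′ → Ins m (x ∷ y ∷ w) (x ∷ y ∷ w′)

insertions : ℕ → List ℕ → List (List ℕ)
insertions m []              = (0 ∷ suc m ∷ []) ∷ []
insertions m (zero  ∷ [])    = (suc m ∷ []) ∷ (0 ∷ suc m ∷ 0 ∷ []) ∷ []
insertions m (suc x ∷ [])    = []
insertions m (zero  ∷ y ∷ r) =
  (suc m ∷ y ∷ r) ∷ (0 ∷ suc m ∷ 0 ∷ y ∷ r) ∷ map (λ w → 0 ∷ y ∷ w) (insertions m r)
insertions m (suc x ∷ y ∷ r) = map (λ w → suc x ∷ y ∷ w) (insertions m r)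

insertions-sound : ∀ m w → All (Ins m w) (insertions m w)
insertions-sound m []              = end ∷ []
insertions-sound m (zero  ∷ [])    = fill ∷ ins ∷ []
insertions-sound m (suc x ∷ [])    = []
insertions-sound m (zero  ∷ y ∷ r) = fill ∷ ins ∷ All.map⁺ (All.map next (insertions-sound m r))
insertions-sound m (suc x ∷ y ∷ r) = All.map⁺ (All.map next (insertions-sound m r))

insertions-complete : ∀ {m w w′} → Ins m w w′ → w′ ∈ insertions m w
insertions-complete end                = here refl
insertions-complete (fill {[]})        = here refl
insertions-complete (fill {_ ∷ _})     = here refl
insertions-complete (ins {[]})         = there (here refl)
insertions-complete (ins {_ ∷ _})      = there (here refl)
insertions-complete (next {zero} i)    = there (there (∈-map⁺ _ (insertions-complete i)))
insertions-complete (next {suc x} i)   = ∈-map⁺ _ (insertions-complete i)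

-- Undoes the insertion of `suc m`. The peaks next to a new valley collapse to one blank whatever
-- they are, so the same map also undoes the joint insertion of a valley and N.
parent : ℕ → List ℕ → List ℕ
parent m [] = []
parent m (x ∷ []) with x ≟ suc m
... | yes _ = 0 ∷ []
... | no  _ = x ∷ []
parent m (x ∷ y ∷ r) with x ≟ suc m | y ≟ suc m
... | yes _ | _     = 0 ∷ y ∷ r
... | no  _ | no  _ = x ∷ y ∷ parent m r
... | no  _ | yes _ with r
...   | []    = []
...   | _ ∷ v = 0 ∷ v

sumOver : (List ℕ → ℕ) → List (List ℕ) → ℕ
sumOver g ws = sum (map g ws)

sumOver-concatMap : ∀ g (f : List ℕ → List (List ℕ)) ws →
  sumOver g (concatMap f ws) ≡ sumOver (λ w → sumOver g (f w)) ws
sumOver-concatMap g f []       = refl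
sumOver-concatMap g f (w ∷ ws) =
  trans (cong sum (map-++ g (f w) (concatMap f ws)))
 (trans (sum-++ (map g (f w)) _)
        (cong (sumOver g (f w) +_) (sumOver-concatMap g f ws)))

sumOver-cong : ∀ {g h} ws → (∀ {w} → w ∈ ws → g w ≡ h w) → sumOver g ws ≡ sumOver h ws
sumOver-cong []       _  = refl
sumOver-cong (w ∷ ws) eq = cong₂ _+_ (eq (here refl)) (sumOver-cong ws (eq ∘ there))

sumOver-map : ∀ g (h : List ℕ → List ℕ) ws → sumOver g (map h ws) ≡ sumOver (g ∘ h) ws
sumOver-map g h ws = cong sum (sym (map-∘ ws))

-- Filling one of the c blanks leaves c - 1 of them, and each of the c + e places for a valley leads
-- to c + 1. The test function is arbitrary because a blank in front turns `f` into `f ∘ suc` in the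
-- recursive call.
insertions-sum : ∀ f m w →
  sumOver (f ∘ blanks) (insertions m w) ≡ transfer (even (length w)) f (blanks w)
insertions-sum f m []              = refl
insertions-sum f m (zero  ∷ [])    = lemma (f 0) (f 2)
  where
  lemma : ∀ x y → x + (y + 0) ≡ 1 * x + 1 * y
  lemma = solve-∀
insertions-sum f m (suc x ∷ [])    = refl
insertions-sum f m (suc x ∷ y ∷ r) =
  trans (sumOver-map (f ∘ blanks) (λ w → suc x ∷ y ∷ w) (insertions m r)) (insertions-sum f m r)
insertions-sum f m (zero  ∷ y ∷ r) =
  trans (cong (λ s → f c + (f (2 + c) + s))
          (trans (sumOver-map (f ∘ blanks) (λ w → 0 ∷ y ∷ w) (insertions m r)) (insertions-sum (f ∘ suc) m r)))
        (regroup c)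
  where
  c = blanks r
  e = even (length r)
  regroup : ∀ c → f c + (f (2 + c) + transfer e (f ∘ suc) c) ≡ transfer e f (suc c)
  regroup zero    = lemma e (f 0) (f 2)
    where
    lemma : ∀ e x y → x + (y + e * y) ≡ 1 * x + (1 + e) * y
    lemma = solve-∀
  regroup (suc c) = lemma e c (f (1 + c)) (f (3 + c))
    where
    lemma : ∀ e c x y → x + (y + ((1 + c) * x + (1 + c + e) * y)) ≡ (2 + c) * x + (2 + c + e) * y
    lemma = solve-∀

insertions-unique : ∀ m {w} → All (_≢ suc m) w → Unique (insertions m w)
insertions-unique m {[]}            _ = [] ∷ []
insertions-unique m {zero  ∷ []}    _ = ((λ ()) ∷ []) ∷ [] ∷ []
insertions-unique m {suc x ∷ []}    _ = []
insertions-unique m {zero  ∷ y ∷ r} (_ ∷ y≢ ∷ r≢) =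
  ((λ ()) ∷ All.map⁺ (All.universal (λ _ ()) _)) ∷
  -- The second letter tells `ins` from `next`: it is `suc m` in the former and `y` in the latter.
  All.map⁺ (All.universal (λ _ eq → y≢ (sym (∷-injectiveˡ (∷-injectiveʳ eq)))) _) ∷
  Unique.map⁺ (∷-injectiveʳ ∘ ∷-injectiveʳ) (insertions-unique m r≢)
insertions-unique m {suc x ∷ y ∷ r} (_ ∷ _ ∷ r≢) =
  Unique.map⁺ (∷-injectiveʳ ∘ ∷-injectiveʳ) (insertions-unique m r≢)

-- Blanks contribute 0 to the count of a positive letter by computation, so only the new letter
-- matters.
Ins-occ : ∀ {m w w′} → Ins m w w′ → ∀ j → occ (suc j) w′ ≡ δ j m + occ (suc j) w
Ins-occ end  j = refl
Ins-occ fill j = refl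
Ins-occ ins  j = refl
Ins-occ {m} (next {x} {y} {w} i) j rewrite Ins-occ i j =
  lemma (δ (suc j) x) (δ (suc j) y) (δ j m) (occ (suc j) w)
  where
  lemma : ∀ a b c d → a + (b + (c + d)) ≡ c + (a + (b + d))
  lemma = solve-∀

Ins-even : ∀ {m w w′} → Ins m w w′ → even (length w′) ≡ even (length w)
Ins-even end      = refl
Ins-even fill     = refl
Ins-even ins      = refl
Ins-even (next i) = Ins-even i

-- The new letter exceeds every valley so far, so it can fill any blank; as a valley it stands next
-- to blanks only.
Ins-alt : ∀ {m p w w′} → Ins m w w′ → Alt m p w → p ≤ m → Alt (suc m) p w′
Ins-alt end  _                  _   = step blank ≤-refl blank []
Ins-alt fill (one _)            p≤m = one (letter p≤m)
Ins-alt fill (step _ y<m _ a)   p≤m = step (letter p≤m) (m<n⇒m<1+n y<m) (letter y<m) (Alt-raise a)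
Ins-alt ins  a                  _   = step blank ≤-refl blank (Alt-blank (Alt-raise a))
Ins-alt (next i) (step p≺x y<m y≺x a) _ = step p≺x (m<n⇒m<1+n y<m) y≺x (Ins-alt i a y<m)

parent-Ins : ∀ {m w w′} → Ins m w w′ → All (_≢ suc m) w → parent m w′ ≡ w
parent-Ins {m} end _ with suc m ≟ suc m
... | yes _ = refl
... | no ≢  = contradiction refl ≢
parent-Ins {m} (fill {[]}) _ with suc m ≟ suc m
... | yes _ = refl
... | no ≢  = contradiction refl ≢
parent-Ins {m} (fill {_ ∷ _}) _ with suc m ≟ suc m
... | yes _ = refl
... | no ≢  = contradiction refl ≢
parent-Ins {m} ins _ with suc m ≟ suc m
... | yes _ = refl
... | no ≢  = contradiction refl ≢
parent-Ins {m} (next {x} {y} i) (x≢ ∷ y≢ ∷ w≢) with x ≟ suc m | y ≟ suc m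
... | yes x≡ | _      = contradiction x≡ x≢
... | no  _  | yes y≡ = contradiction y≡ y≢
... | no  _  | no  _  = cong (λ w → x ∷ y ∷ w) (parent-Ins i w≢)

-- Placing N together with its greater neighbour.

module Marked (n : ℕ) where

  N : ℕ
  N = suc n

  -- The new valley suc k is inserted together with N, which takes an adjacent blank.
  data Mark (k : ℕ) : List ℕ → List ℕ → Set where
    end   : Mark k [] (N ∷ suc k ∷ [])
    left  : ∀ {v} → Mark k (0 ∷ v) (N ∷ suc k ∷ 0 ∷ v)
    right : ∀ {v} → Mark k (0 ∷ v) (0 ∷ suc k ∷ N ∷ v)
    next  : ∀ {x y w w′} → Mark k w w′ → Mark k (x ∷ y ∷ w) (x ∷ y ∷ w′)

  markings : ℕ → List ℕ → List (List ℕ)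
  markings k []              = (N ∷ suc k ∷ []) ∷ []
  markings k (zero  ∷ [])    = (N ∷ suc k ∷ 0 ∷ []) ∷ (0 ∷ suc k ∷ N ∷ []) ∷ []
  markings k (suc x ∷ [])    = []
  markings k (zero  ∷ y ∷ r) =
    (N ∷ suc k ∷ 0 ∷ y ∷ r) ∷ (0 ∷ suc k ∷ N ∷ y ∷ r) ∷ map (λ w → 0 ∷ y ∷ w) (markings k r)
  markings k (suc x ∷ y ∷ r) = map (λ w → suc x ∷ y ∷ w) (markings k r)

  markings-sound : ∀ k w → All (Mark k w) (markings k w)
  markings-sound k []              = end ∷ []
  markings-sound k (zero  ∷ [])    = left ∷ right ∷ []
  markings-sound k (suc x ∷ [])    = []
  markings-sound k (zero  ∷ y ∷ r) = left ∷ right ∷ All.map⁺ (All.map next (markings-sound k r))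
  markings-sound k (suc x ∷ y ∷ r) = All.map⁺ (All.map next (markings-sound k r))

  markings-complete : ∀ {k w w′} → Mark k w w′ → w′ ∈ markings k w
  markings-complete end              = here refl
  markings-complete (left {[]})      = here refl
  markings-complete (left {_ ∷ _})   = here refl
  markings-complete (right {[]})     = there (here refl)
  markings-complete (right {_ ∷ _})  = there (here refl)
  markings-complete (next {zero} i)  = there (there (∈-map⁺ _ (markings-complete i)))
  markings-complete (next {suc x} i) = ∈-map⁺ _ (markings-complete i)

  -- A valley inserted before one of the c blanks lets N choose between left and right; at the end
  -- of the word only the left is available. N uses up the additional blank, so c does not change.
  markings-sum : ∀ f k w → let c = blanks w in
    sumOver (f ∘ blanks) (markings k w) ≡ (c + c + even (length w)) * f c
  markings-sum f k []              = refl
  markings-sum f k (zero  ∷ [])    = refl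
  markings-sum f k (suc x ∷ [])    = refl
  markings-sum f k (suc x ∷ y ∷ r) =
    trans (sumOver-map (f ∘ blanks) (λ w → suc x ∷ y ∷ w) (markings k r)) (markings-sum f k r)
  markings-sum f k (zero  ∷ y ∷ r) =
    trans (cong (λ s → f (suc c) + (f (suc c) + s))
            (trans (sumOver-map (f ∘ blanks) (λ w → 0 ∷ y ∷ w) (markings k r)) (markings-sum (f ∘ suc) k r)))
          (lemma c (even (length r)) (f (suc c)))
    where
    c = blanks r
    lemma : ∀ c e x → x + (x + (c + c + e) * x) ≡ (1 + c + (1 + c) + e) * x
    lemma = solve-∀

  markings-unique : ∀ k {w} → All (_≢ suc k) w → Unique (markings k w)
  markings-unique k {[]}            _ = [] ∷ []
  markings-unique k {zero  ∷ []}    _ = ((λ ()) ∷ []) ∷ [] ∷ []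
  markings-unique k {suc x ∷ []}    _ = []
  markings-unique k {zero  ∷ y ∷ r} (_ ∷ y≢ ∷ r≢) =
    ((λ ()) ∷ All.map⁺ (All.universal (λ _ ()) _)) ∷
    All.map⁺ (All.universal (λ _ eq → y≢ (sym (∷-injectiveˡ (∷-injectiveʳ eq)))) _) ∷
    Unique.map⁺ (∷-injectiveʳ ∘ ∷-injectiveʳ) (markings-unique k r≢)
  markings-unique k {suc x ∷ y ∷ r} (_ ∷ _ ∷ r≢) =
    Unique.map⁺ (∷-injectiveʳ ∘ ∷-injectiveʳ) (markings-unique k r≢)

  parent-Mark : ∀ {k w w′} → Mark k w w′ → k < n → All (_≢ suc k) w → parent k w′ ≡ w
  parent-Mark {k} end k<n _ with N ≟ suc k | suc k ≟ suc k
  ... | yes refl | _     = contradiction k<n (<-irrefl refl)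
  ... | no  _    | no ≢  = contradiction refl ≢
  ... | no  _    | yes _ = refl
  parent-Mark {k} left k<n _ with N ≟ suc k | suc k ≟ suc k
  ... | yes refl | _     = contradiction k<n (<-irrefl refl)
  ... | no  _    | no ≢  = contradiction refl ≢
  ... | no  _    | yes _ = refl
  parent-Mark {k} right k<n _ with suc k ≟ suc k
  ... | yes _ = refl
  ... | no ≢  = contradiction refl ≢
  parent-Mark {k} (next {x} {y} i) k<n (x≢ ∷ y≢ ∷ w≢) with x ≟ suc k | y ≟ suc k
  ... | yes x≡ | _      = contradiction x≡ x≢
  ... | no  _  | yes y≡ = contradiction y≡ y≢
  ... | no  _  | no  _  = cong (λ w → x ∷ y ∷ w) (parent-Mark i k<n w≢)

  Mark-occ : ∀ {k w w′} → Mark k w w′ → ∀ j → occ (suc j) w′ ≡ δ j n + (δ j k + occ (suc j) w)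
  Mark-occ end  j = refl
  Mark-occ left j = refl
  Mark-occ {k} (right {v}) j = lemma (δ j n) (δ j k) (occ (suc j) v)
    where
    lemma : ∀ a b c → b + (a + c) ≡ a + (b + c)
    lemma = solve-∀
  Mark-occ {k} (next {x} {y} {w} i) j rewrite Mark-occ i j =
    lemma (δ (suc j) x) (δ (suc j) y) (δ j n) (δ j k) (occ (suc j) w)
    where
    lemma : ∀ a b c d f → a + (b + (c + (d + f))) ≡ c + (d + (a + (b + f)))
    lemma = solve-∀

  Mark-even : ∀ {k w w′} → Mark k w w′ → even (length w′) ≡ even (length w)
  Mark-even end      = refl
  Mark-even left     = refl
  Mark-even right    = refl
  Mark-even (next i) = Mark-even i

  Mark-alt : ∀ {k p w w′} → Mark k w w′ → k < n → Alt k p w → p ≤ k → Alt (suc k) p w′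
  Mark-alt end   k<n _ p≤k = step (letter (≤-trans p≤k (<⇒≤ k<n))) ≤-refl (letter k<n) []
  Mark-alt left  k<n a p≤k =
    step (letter (≤-trans p≤k (<⇒≤ k<n))) ≤-refl (letter k<n) (Alt-blank (Alt-raise a))
  Mark-alt right k<n (one _) _ = step blank ≤-refl blank (one (letter k<n))
  Mark-alt right k<n (step _ y<k _ a) _ =
    step blank ≤-refl blank (step (letter k<n) (m<n⇒m<1+n y<k) (letter (<-trans y<k k<n)) (Alt-raise a))
  Mark-alt (next i) k<n (step p≺x y<k y≺x a) _ = step p≺x (m<n⇒m<1+n y<k) y≺x (Mark-alt i k<n a y<k)

  -- The greater neighbour of N.

  <⇒≡ᵇ-false : ∀ {y} → y < n → (y ≡ᵇ n) ≡ false
  <⇒≡ᵇ-false y<n = ≢⇒≡ᵇ-false (<⇒≢ y<n)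

  -- Valleys are at most b ≤ n, so N can occur only at a peak. Its neighbours are then valleys, and
  -- an insertion neither alters them nor separates them from N.
  Ins-grn : ∀ {m b p w w′} → Ins m w w′ → m < n → b ≤ n → Alt b p w → grnAux N p w′ ≡ grnAux N p w
  Ins-grn end  m<n _ _ rewrite <⇒≡ᵇ-false m<n = refl
  Ins-grn fill m<n _ (one _) rewrite <⇒≡ᵇ-false m<n = refl
  Ins-grn fill m<n b≤n (step _ y<b _ _)
    rewrite <⇒≡ᵇ-false m<n | <⇒≡ᵇ-false (<-≤-trans y<b b≤n) = refl
  Ins-grn ins  m<n _ _ rewrite <⇒≡ᵇ-false m<n = refl
  Ins-grn (next {x} i) m<n b≤n (step _ y<b _ a) with x ≡ᵇ N
  ... | true  = refl
  ... | false rewrite <⇒≡ᵇ-false (<-≤-trans y<b b≤n) = Ins-grn i m<n b≤n a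

  -- All earlier valleys are at most `k`, so `suc k` is the greater of the two neighbours.
  Mark-grn : ∀ {k p w w′} → Mark k w w′ → k < n → Alt k p w → p ≤ k → All (_≢ N) w →
             grnAux N p w′ ≡ suc k
  Mark-grn end  k<n _ p≤k _ rewrite ≡ᵇ-refl n = m≤n⇒m⊔n≡n (m≤n⇒m≤1+n p≤k)
  Mark-grn left k<n _ p≤k _ rewrite ≡ᵇ-refl n = m≤n⇒m⊔n≡n (m≤n⇒m≤1+n p≤k)
  Mark-grn right k<n (one _) _ _ rewrite <⇒≡ᵇ-false k<n | ≡ᵇ-refl n = refl
  Mark-grn right k<n (step _ y<k _ _) _ _ rewrite <⇒≡ᵇ-false k<n | ≡ᵇ-refl n =
    cong suc (m≥n⇒m⊔n≡m (<⇒≤ y<k))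
  Mark-grn (next i) k<n (step _ y<k _ a) _ (x≢ ∷ y≢ ∷ w≢)
    rewrite ≢⇒≡ᵇ-false x≢ | ≢⇒≡ᵇ-false y≢ = Mark-grn i k<n a y<k w≢

  -- Content and parity of partially built words.

  -- The argument j stands for the letter suc j.
  μ : ℕ → ℕ → ℕ
  μ zero    j = 0
  μ (suc m) j = δ j m + μ m j

  μ-≥ : ∀ m {j} → m ≤ j → μ m j ≡ 0
  μ-≥ zero    _   = refl
  μ-≥ (suc m) m<j rewrite δ-≢ (>⇒≢ m<j) = μ-≥ m (<⇒≤ m<j)

  μ-< : ∀ m {j} → j < m → μ m j ≡ 1
  μ-< (suc m) {j} j≤m with j ≟ m
  ... | yes refl rewrite δ-refl j | μ-≥ j {j} ≤-refl = refl
  ... | no  j≢m  rewrite δ-≢ j≢m = μ-< m (≤∧≢⇒< (≤-pred j≤m) j≢m)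

  -- s = 1 once N has been placed, and s = 0 before.
  record Stage (s e m : ℕ) (w : List ℕ) : Set where
    constructor stage
    field
      alt      : Alt m 0 w
      content  : ∀ j → occ (suc j) w ≡ s * δ j n + μ m j
      evenness : even (length w) ≡ e
  open Stage

  Stage-fresh : ∀ {s e m w} → m < n → Stage s e m w → All (_≢ suc m) w
  Stage-fresh {s} {m = m} m<n st = occ≡0⇒≢ (trans (content st m)
    (cong₂ _+_ (trans (cong (s *_) (δ-≢ (<⇒≢ m<n))) (*-zeroʳ s)) (μ-≥ m {m} ≤-refl)))

  Stage-letters : ∀ {s e m w} → Stage s e m w → All (λ x → x ≤ m ⊎ x ≡ N) w
  Stage-letters {s} {m = m} {w} st = All.tabulate bound
    where
    bound : ∀ {x} → x ∈ w → x ≤ m ⊎ x ≡ N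
    bound {zero}  _  = inj₁ z≤n
    bound {suc j} x∈ with j <? m | j ≟ n
    ... | yes j<m | _        = inj₁ j<m
    ... | no  _   | yes refl = inj₂ refl
    ... | no  j≮m | no j≢n   = contradiction (sym absent) (<⇒≢ (∈⇒occ>0 x∈))
      where
      absent : occ (suc j) w ≡ 0
      absent = trans (content st j)
        (cong₂ _+_ (trans (cong (s *_) (δ-≢ j≢n)) (*-zeroʳ s)) (μ-≥ m (≮⇒≥ j≮m)))

  Ins-Stage : ∀ {s e m w w′} → Ins m w w′ → Stage s e m w → Stage s e (suc m) w′
  Ins-Stage {s} {m = m} i (stage a c p) =
    stage (Ins-alt i a z≤n)
          (λ j → trans (Ins-occ i j) (trans (cong (δ j m +_) (c j)) (lemma (δ j m) (s * δ j n) (μ m j))))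
          (trans (Ins-even i) p)
    where
    lemma : ∀ a b c → a + (b + c) ≡ b + (a + c)
    lemma = solve-∀

  Mark-Stage : ∀ {e k w w′} → Mark k w w′ → k < n → Stage 0 e k w → Stage 1 e (suc k) w′
  Mark-Stage {k = k} i k<n (stage a c p) =
    stage (Mark-alt i k<n a z≤n)
          (λ j → trans (Mark-occ i j)
            (cong₂ _+_ (sym (+-identityʳ (δ j n))) (cong (δ j k +_) (c j))))
          (trans (Mark-even i) p)

  -- Undoing the last insertion.

  Ins-Stage⁻ : ∀ {s e m w w′} → Ins m w w′ → Alt m 0 w → Stage s e (suc m) w′ → Stage s e m w
  Ins-Stage⁻ {s} {m = m} {w} i a (stage _ c p) =
    stage a (λ j → +-cancelˡ-≡ (δ j m) _ _
              (trans (sym (Ins-occ i j)) (trans (c j) (lemma (δ j m) (s * δ j n) (μ m j)))))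
          (trans (sym (Ins-even i)) p)
    where
    lemma : ∀ a b c → b + (a + c) ≡ a + (b + c)
    lemma = solve-∀

  Mark-Stage⁻ : ∀ {e k w w′} → Mark k w w′ → Alt k 0 w → Stage 1 e (suc k) w′ → Stage 0 e k w
  Mark-Stage⁻ {k = k} {w} i a (stage _ c p) =
    stage a (λ j → +-cancelˡ-≡ (δ j k) _ _ (+-cancelˡ-≡ (δ j n) _ _
              (trans (sym (Mark-occ i j)) (trans (c j) (cong (_+ μ (suc k) j) (+-identityʳ (δ j n)))))))
          (trans (sym (Mark-even i)) p)

  -- Among the letters placed so far only N exceeds `suc m`, which leaves a blank as the other
  -- possibility for a peak next to it.
  above : ∀ {m z} → suc m ≺ z → z ≤ suc m ⊎ z ≡ N → z ≡ 0 ⊎ z ≡ N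
  above blank      _         = inj₁ refl
  above (letter p) (inj₁ q)  = contradiction p (<⇒≱ q)
  above (letter _) (inj₂ eq) = inj₂ eq

  -- The neighbours of the largest valley are blanks, except that one of them can be N.
  decompose-valley : ∀ {m p x r} → Alt (suc m) (suc m) r → All (λ x → x ≤ suc m ⊎ x ≡ N) r →
                     x ≡ 0 ⊎ x ≡ N → occ (suc m) r ≡ 0 → occ N (x ∷ suc m ∷ r) ≤ 1 →
                     ∃ λ v → (Ins m v (x ∷ suc m ∷ r) ⊎ Mark m v (x ∷ suc m ∷ r)) × Alt m p v
  decompose-valley [] _ (inj₁ refl) _ _ = [] , inj₁ end , []
  decompose-valley [] _ (inj₂ refl) _ _ = [] , inj₂ end , []
  decompose-valley {m} {r = z ∷ v} a (z≤ ∷ _) x≡ o oN with above (Alt-head a) z≤ | x≡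
  ... | inj₁ refl | inj₁ refl = 0 ∷ v , inj₁ ins , Alt-blank (Alt-lower a o)
  ... | inj₁ refl | inj₂ refl = 0 ∷ v , inj₂ left , Alt-blank (Alt-lower a o)
  ... | inj₂ refl | inj₁ refl =
    0 ∷ v , inj₂ right , Alt-blank (Alt-lower a o)
  ... | inj₂ refl | inj₂ refl = contradiction oN (<⇒≱ twice)
    where
    twice : 2 ≤ δ n n + (δ n m + (δ n n + occ N v))
    twice rewrite δ-refl n = s≤s (≤-trans (s≤s z≤n) (m≤n+m _ (δ n m)))

  -- Search for the single occurrence of `suc m`. At a peak it is erased to a blank; at a valley
  -- `decompose-valley` applies; otherwise the search continues two letters later.
  decompose : ∀ {m p w} → m < n → Alt (suc m) p w → All (λ x → x ≤ suc m ⊎ x ≡ N) w →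
              occ (suc m) w ≡ 1 → occ N w ≤ 1 → ∃ λ v → (Ins m v w ⊎ Mark m v w) × Alt m p v
  decompose m<n [] _ () _
  decompose {m} m<n (one {x} p≺x) _ o _ with x ≟ suc m
  ... | yes refl = 0 ∷ [] , inj₁ fill , one blank
  ... | no  x≢   = case trans (sym (cong (_+ 0) (δ-≢ (x≢ ∘ sym)))) o of λ ()
  decompose {m} m<n (step {x} {y} {r} p≺x y≤m y≺x a) (x≤ ∷ _ ∷ r≤) o oN with x ≟ suc m
  -- The valley after the peak `suc m` lies below it, which gives the sharper bound on that valley.
  decompose {m} m<n (step {x} {y} {r} p≺x y≤m (letter y<m) a) (x≤ ∷ _ ∷ r≤) o oN | yes refl =
    0 ∷ suc y ∷ r , inj₁ fill , step blank y<m blank (Alt-lower a (m+n≡0⇒n≡0 (δ m y) o′))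
    where
    o′ : δ m y + occ (suc m) r ≡ 0
    o′ = suc-injective (subst (λ d → d + (δ m y + occ (suc m) r) ≡ 1) (δ-refl m) o)
  ... | no x≢ with y ≟ m
  ...   | no y≢ =
    extend (decompose m<n a r≤ o″ (≤-trans (m≤n+m _ (δ N (suc y))) (≤-trans (m≤n+m _ (δ N x)) oN)))
    where
    o″ : occ (suc m) r ≡ 1
    o″ = trans (sym (cong₂ (λ d d′ → d + (d′ + occ (suc m) r)) (δ-≢ (x≢ ∘ sym)) (δ-≢ (y≢ ∘ sym)))) o
    extend : (∃ λ v → (Ins m v r ⊎ Mark m v r) × Alt m (suc y) v) →
             ∃ λ v → (Ins m v (x ∷ suc y ∷ r) ⊎ Mark m v (x ∷ suc y ∷ r)) × Alt m _ v
    extend (v , i , b) =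
      x ∷ suc y ∷ v , Sum.map next next i , step p≺x (≤∧≢⇒< (≤-pred y≤m) y≢) y≺x b
  ...   | yes refl = decompose-valley a r≤ (above y≺x x≤) o″ oN
    where
    o″ : occ (suc m) r ≡ 0
    o″ = suc-injective (trans (sym (cong₂ (λ d d′ → d + (d′ + occ (suc m) r)) (δ-≢ (x≢ ∘ sym)) (δ-refl m))) o)

  -- `decompose` finds the shape of the last step, and cancelling the contribution of the inserted
  -- letters gives the earlier content.
  Stage-split : ∀ {s e m w} → s ≤ 1 → m < n → Stage s e (suc m) w →
                ∃ λ v → (Ins m v w × Stage s e m v) ⊎ (s ≡ 1 × Mark m v w × Stage 0 e m v)
  Stage-split {s} {e} {m} {w} s≤1 m<n st@(stage a c _) =
    split s≤1 st (decompose m<n a (Stage-letters st) once N≤1)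
    where
    once : occ (suc m) w ≡ 1
    once rewrite c m | δ-≢ (<⇒≢ m<n) | *-zeroʳ s | δ-refl m | μ-≥ m {m} ≤-refl = refl
    N≤1 : occ N w ≤ 1
    N≤1 rewrite c n | δ-refl n | μ-≥ (suc m) m<n | *-identityʳ s | +-identityʳ s = s≤1
    split : ∀ {s} → s ≤ 1 → Stage s e (suc m) w → (∃ λ v → (Ins m v w ⊎ Mark m v w) × Alt m 0 v) →
            ∃ λ v → (Ins m v w × Stage s e m v) ⊎ (s ≡ 1 × Mark m v w × Stage 0 e m v)
    split _         st (v , inj₁ i , b) = v , inj₁ (i , Ins-Stage⁻ i b st)
    split (s≤s z≤n) st (v , inj₂ i , b) = v , inj₂ (refl , i , Mark-Stage⁻ i b st)
    -- A marking would put N into `w`, but for s = 0 it is absent.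
    split z≤n       st (v , inj₂ i , b) = case trans (sym absent) (Mark-occ i n) of
      λ eq → case trans eq (cong (_+ (δ n m + occ N v)) (δ-refl n)) of λ ()
      where
      absent : occ N w ≡ 0
      absent = trans (content st n) (μ-≥ (suc m) m<n)

  -- Enumeration of the partially built words.

  unmarked : ℕ → ℕ → List (List ℕ)
  unmarked e zero    = start e ∷ []
  unmarked e (suc m) = concatMap (insertions m) (unmarked e m)

  -- For k = 0 the letter N is not next to any smaller letter, so it is the whole word.
  justMarked : ℕ → ℕ → List (List ℕ)
  justMarked e       (suc k) = concatMap (markings k) (unmarked e k)
  justMarked zero    zero    = (N ∷ []) ∷ []
  justMarked (suc _) zero    = []

  -- N is placed together with the letter `k`, and `t` more letters follow, so 1, ..., t + k are
  -- present and the next letter is `suc (t + k)`.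
  marked : ℕ → ℕ → ℕ → List (List ℕ)
  marked e k zero    = justMarked e k
  marked e k (suc t) = concatMap (insertions (t + k)) (marked e k t)

  unmarked-sound : ∀ {e m w} → e ≤ 1 → w ∈ unmarked e m → Stage 0 e m w
  unmarked-sound {m = zero} z≤n       (here refl) = stage (one blank) (λ _ → refl) refl
  unmarked-sound {m = zero} (s≤s z≤n) (here refl) = stage [] (λ _ → refl) refl
  unmarked-sound {e} {suc m} e≤1 w∈ with v , v∈ , w∈v ← ∈-concatMap⇒ (insertions m) (unmarked e m) w∈ =
    Ins-Stage (All.lookup (insertions-sound m v) w∈v) (unmarked-sound e≤1 v∈)

  unmarked-complete : ∀ {e m w} → m ≤ n → Stage 0 e m w → w ∈ unmarked e m
  -- For m = 0 no valley is within the bound, so the word has at most one letter.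
  unmarked-complete {m = zero} _ (stage []                  _ refl) = here refl
  unmarked-complete {m = zero} _ (stage (one blank)         _ refl) = here refl
  unmarked-complete {m = zero} _ (stage (one (letter {x} _)) c _)   =
    case trans (sym (trans (+-identityʳ (δ x x)) (δ-refl x))) (c x) of λ ()
  unmarked-complete {m = suc m} m<n st with Stage-split z≤n m<n st
  ... | v , inj₁ (i , st′) =
    ⇒∈-concatMap (insertions m) (unmarked-complete (<⇒≤ m<n) st′) (insertions-complete i)
  ... | _ , inj₂ (() , _)

  unmarked-unique : ∀ {e} m → e ≤ 1 → m ≤ n → Unique (unmarked e m)
  unmarked-unique     zero    _   _   = [] ∷ []
  unmarked-unique {e} (suc m) e≤1 m<n =
    concatMap-unique (insertions m) (parent m) (unmarked e m) (unmarked-unique m e≤1 (<⇒≤ m<n))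
      (λ v∈ → insertions-unique m (fresh v∈))
      (λ v∈ w∈ → parent-Ins (All.lookup (insertions-sound m _) w∈) (fresh v∈))
    where
    fresh : ∀ {v} → v ∈ unmarked e m → All (_≢ suc m) v
    fresh v∈ = Stage-fresh m<n (unmarked-sound e≤1 v∈)

  -- The greater neighbour becomes `k` when N is placed and later insertions preserve it.
  marked-sound : ∀ {e} k t {w} → e ≤ 1 → t + k ≤ n → w ∈ marked e k t →
                 Stage 1 e (t + k) w × grn N w ≡ k
  marked-sound {zero}  zero zero _ _ (here refl) = stage (one (letter z≤n)) (λ _ → sym (+-identityʳ _)) refl , grn≡0
    where
    grn≡0 : grn N (N ∷ []) ≡ 0
    grn≡0 rewrite ≡ᵇ-refl n = refl
  marked-sound {suc _} zero zero _ _ ()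
  marked-sound {e} (suc k) zero e≤1 k<n w∈
    with v , v∈ , w∈v ← ∈-concatMap⇒ (markings k) (unmarked e k) w∈ =
    Mark-Stage i k<n st , Mark-grn i k<n (alt st) z≤n (occ≡0⇒≢ (trans (content st n) (μ-≥ k (<⇒≤ k<n))))
    where
    i  = All.lookup (markings-sound k v) w∈v
    st = unmarked-sound e≤1 v∈
  marked-sound {e} k (suc t) e≤1 m<n w∈
    with v , v∈ , w∈v ← ∈-concatMap⇒ (insertions (t + k)) (marked e k t) w∈
    with st , grn≡ ← marked-sound k t e≤1 (<⇒≤ m<n) v∈ =
    Ins-Stage i st , trans (Ins-grn i m<n (<⇒≤ m<n) (alt st)) grn≡
    where
    i = All.lookup (insertions-sound (t + k) v) w∈v

  -- Going back one letter at a time leads to the step that placed N, whose letter is `k`, or else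
  -- to the word consisting of N alone, where `k` is 0.
  marked-complete : ∀ {e} m {w} → m ≤ n → Stage 1 e m w → ∃₂ λ k t → t + k ≡ m × w ∈ marked e k t
  marked-complete zero _ (stage [] c _) =
    case trans (c n) (cong (λ d → d + 0 + 0) (δ-refl n)) of λ ()
  marked-complete zero _ (stage (one blank) c _) =
    case trans (c n) (cong (λ d → d + 0 + 0) (δ-refl n)) of λ ()
  marked-complete zero _ (stage (one (letter {x} _)) c refl) with n ≟ x
  ... | yes refl = 0 , 0 , refl , here refl
  ... | no  n≢x  = case trans (sym (cong (_+ 0) (δ-≢ n≢x)))
                         (trans (c n) (cong (λ d → d + 0 + 0) (δ-refl n))) of λ ()
  marked-complete {e} (suc m) m<n st with Stage-split ≤-refl m<n st
  ... | v , inj₁ (i , st′) with k , t , refl , v∈ ← marked-complete m (<⇒≤ m<n) st′ =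
    k , suc t , refl , ⇒∈-concatMap (insertions m) v∈ (insertions-complete i)
  ... | v , inj₂ (_ , i , st′) =
    suc m , 0 , refl , ⇒∈-concatMap (markings m) (unmarked-complete (<⇒≤ m<n) st′) (markings-complete i)

  marked-unique : ∀ {e} k t → e ≤ 1 → t + k ≤ n → Unique (marked e k t)
  marked-unique {zero}  zero zero _ _ = [] ∷ []
  marked-unique {suc _} zero zero _ _ = []
  marked-unique {e} (suc k) zero e≤1 k<n =
    concatMap-unique (markings k) (parent k) (unmarked e k) (unmarked-unique k e≤1 (<⇒≤ k<n))
      (λ v∈ → markings-unique k (fresh v∈))
      (λ v∈ w∈ → parent-Mark (All.lookup (markings-sound k _) w∈) k<n (fresh v∈))
    where
    fresh : ∀ {v} → v ∈ unmarked e k → All (_≢ suc k) v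
    fresh v∈ = Stage-fresh k<n (unmarked-sound e≤1 v∈)
  marked-unique {e} k (suc t) e≤1 m<n =
    concatMap-unique (insertions (t + k)) (parent (t + k)) (marked e k t) (marked-unique k t e≤1 (<⇒≤ m<n))
      (λ v∈ → insertions-unique (t + k) (fresh v∈))
      (λ v∈ w∈ → parent-Ins (All.lookup (insertions-sound (t + k) _) w∈) (fresh v∈))
    where
    fresh : ∀ {v} → v ∈ marked e k t → All (_≢ suc (t + k)) v
    fresh v∈ = Stage-fresh m<n (proj₁ (marked-sound k t e≤1 (<⇒≤ m<n) v∈))

  -- Finished words are the alternating permutations.

  letters : List ℕ
  letters = applyUpTo suc N

  letters-unique : Unique letters
  letters-unique = Unique.applyUpTo⁺₁ suc N (λ i<j _ → <⇒≢ i<j ∘ suc-injective)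

  Letter⇒∈ : ∀ {x} → Letter N x → x ∈ letters
  Letter⇒∈ {suc x} (_ , x<N) = ∈-applyUpTo⁺ suc x<N

  Stage⇒content : ∀ {e w} → Stage 1 e n w → ∀ j → occ (suc j) w ≡ μ N j
  Stage⇒content st j = trans (content st j) (cong (_+ μ n j) (+-identityʳ (δ j n)))

  μ≤1 : ∀ m j → μ m j ≤ 1
  μ≤1 m j with j <? m
  ... | yes j<m = ≤-reflexive (μ-< m j<m)
  ... | no  j≮m = ≤-trans (≤-reflexive (μ-≥ m (≮⇒≥ j≮m))) z≤n

  <⇒<ᵇ-true : ∀ {x y} → x < y → (x <ᵇ y) ≡ true
  <⇒<ᵇ-true p = Equivalence.to T-≡ (<⇒<ᵇ p)

  <ᵇ-true⇒< : ∀ x y → (x <ᵇ y) ≡ true → x < y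
  <ᵇ-true⇒< x y eq = <ᵇ⇒< x y (Equivalence.from T-≡ eq)

  Alt-positive : ∀ {b p w} → Alt b p w → blanks w ≡ 0 → All (0 <_) w
  Alt-positive []                  _ = []
  Alt-positive (one (letter _))    _ = z<s ∷ []
  Alt-positive (step (letter _) _ _ a) o = z<s ∷ z<s ∷ Alt-positive a o

  positive⇒blanks≡0 : ∀ {w} → All (0 <_) w → blanks w ≡ 0
  positive⇒blanks≡0 []                              = refl
  positive⇒blanks≡0 {suc _ ∷ []}    _               = refl
  positive⇒blanks≡0 {suc _ ∷ _ ∷ _} (_ ∷ _ ∷ ps) = positive⇒blanks≡0 ps

  Alt⇒altUp : ∀ {b p w} → Alt b p w → blanks w ≡ 0 → altUp (p ∷ w) ≡ true
  Alt⇒altUp []                                  _ = refl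
  Alt⇒altUp (one (letter p≤x))                  _ rewrite <⇒<ᵇ-true (s≤s p≤x) = refl
  Alt⇒altUp (step (letter p≤x) _ (letter y<x) a) o
    rewrite <⇒<ᵇ-true (s≤s p≤x) | <⇒<ᵇ-true y<x = Alt⇒altUp a o

  altUp⇒Alt : ∀ {p w} → altUp (p ∷ w) ≡ true → All (Letter N) w → Alt n p w
  altUp⇒Alt _ [] = []
  altUp⇒Alt {p} {suc x ∷ []} u _ = one (letter (≤-pred (<ᵇ-true⇒< p (suc x) (∧-conicalˡ _ _ u))))
  altUp⇒Alt {p} {suc x ∷ suc y ∷ r} u (x≤ ∷ y≤ ∷ ls) =
    -- A valley lies below the peak before it and is therefore at most n.
    step (letter (≤-pred (<ᵇ-true⇒< p (suc x) (∧-conicalˡ _ _ u)))) (<-≤-trans y<x (≤-pred (proj₂ x≤)))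
         (letter y<x) (altUp⇒Alt (∧-conicalʳ _ _ d) ls)
    where
    d : ((y <ᵇ x) ∧ altUp (suc y ∷ r)) ≡ true
    d = ∧-conicalʳ (p <ᵇ suc x) _ u
    y<x : y < x
    y<x = <ᵇ-true⇒< y x (∧-conicalˡ _ _ d)

  -- The leading 0 is the valley p = 0 from which `Alt` starts.
  altDown≡altUp : ∀ {w} → All (0 <_) w → altDown w ≡ altUp (0 ∷ w)
  altDown≡altUp []                  = refl
  altDown≡altUp {suc x ∷ w} (_ ∷ _) = refl

  finished : ℕ → ℕ → ℕ → List (List ℕ)
  finished e k t = filter (λ w → blanks w ≟ 0) (marked e k t)

  finished⊆𝔄 : ∀ k t → t + k ≡ n → finished (even N) k t ⊆ 𝔄 N k
  finished⊆𝔄 k t refl {w} w∈ with w∈m , b≡0 ← ∈-filter⁻ (λ w → blanks w ≟ 0) {xs = marked (even N) k t} w∈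
                              with st , grn≡k ← marked-sound k t (even≤1 N) ≤-refl w∈m =
    ∈-filter⁺ _ (subst (λ l → w ∈ words l N) len (∈-words⁺ ls)) conditions
    where
    pos : All (0 <_) w
    pos = Alt-positive (alt st) b≡0
    ls : All (Letter N) w
    ls = All.zipWith (λ { (p , inj₁ x≤) → p , m≤n⇒m≤1+n x≤ ; (p , inj₂ refl) → p , ≤-refl })
                     (pos , Stage-letters st)
    w! : Unique w
    w! = occ≤1⇒unique w λ where
      zero    → ≤-trans (≮⇒≥ (λ o → <-irrefl refl (All.lookup pos (occ>0⇒∈ w o)))) z≤n
      (suc j) → subst (_≤ 1) (sym (Stage⇒content st j)) (μ≤1 N j)
    letters⊆ : letters ⊆ w
    letters⊆ x∈ with i , i<N , refl ← ∈-applyUpTo⁻ suc x∈ =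
      occ>0⇒∈ w (≤-reflexive (sym (trans (Stage⇒content st i) (μ-< N i<N))))
    -- `Stage` records no length; it follows because `w` and `letters` are duplicate-free with the
    -- same entries.
    len : length w ≡ N
    len = trans (unique-⊆⊇⇒length≡ w! letters-unique (λ x∈ → Letter⇒∈ (All.lookup ls x∈)) letters⊆)
                (length-applyUpTo suc N)
    conditions : (distinct w ∧ altDown w ∧ (grn N w ≡ᵇ k)) ≡ true
    conditions rewrite unique⇒distinct w! | altDown≡altUp pos | Alt⇒altUp (alt st) b≡0 | grn≡k = ≡ᵇ-refl k

  -- A duplicate-free word of N letters from 1, ..., N uses all of them, so each occurs exactly
  -- once.
  alternating⇒Stage : ∀ {w} → length w ≡ N → All (Letter N) w → distinct w ≡ true → altDown w ≡ true →
                      Stage 1 (even N) n w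
  alternating⇒Stage {w} len ls d a = stage
    (altUp⇒Alt (trans (sym (altDown≡altUp (All.map proj₁ ls))) a) ls)
    (λ j → trans (occ≡μ j) (cong (_+ μ n j) (sym (+-identityʳ (δ j n)))))
    (cong even len)
    where
    w! : Unique w
    w! = distinct⇒unique w d
    letters⊆ : letters ⊆ w
    letters⊆ = unique-⊆-length≥⇒⊇ w! (λ x∈ → Letter⇒∈ (All.lookup ls x∈))
                 (≤-reflexive (trans (length-applyUpTo suc N) (sym len)))
    occ≡μ : ∀ j → occ (suc j) w ≡ μ N j
    occ≡μ j with j <? N
    ... | yes j<N = trans (≤-antisym (unique⇒occ≤1 (suc j) w!) (∈⇒occ>0 (letters⊆ (∈-applyUpTo⁺ suc j<N))))
                          (sym (μ-< N j<N))
    ... | no  j≮N = trans (n≤0⇒n≡0 (≮⇒≥ λ o → j≮N (proj₂ (All.lookup ls (occ>0⇒∈ w o)))))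
                          (sym (μ-≥ N (≮⇒≥ j≮N)))

  𝔄⊆finished : ∀ k t → t + k ≡ n → 𝔄 N k ⊆ finished (even N) k t
  𝔄⊆finished k t t+k≡n {w} w∈
    with w∈words , conditions ← ∈-filter⁻ _ {xs = words N N} w∈
    with len , ls ← ∈-words⁻ N N w∈words
    with d ← ∧-conicalˡ (distinct w) _ conditions
       | a∧g ← ∧-conicalʳ (distinct w) _ conditions
    with a ← ∧-conicalˡ (altDown w) _ a∧g | g ← ∧-conicalʳ (altDown w) _ a∧g
    with k′ , t′ , t′+k′≡n , w∈m ← marked-complete n ≤-refl (alternating⇒Stage len ls d a)
    -- Both `k` and `k′` are the greater neighbour of N in `w`, so they agree, and with them `t` and
    -- `t′`.
    with refl ← trans (sym (≡ᵇ⇒≡ (grn N w) k (Equivalence.from T-≡ g)))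
                      (proj₂ (marked-sound k′ t′ (even≤1 N) (≤-reflexive t′+k′≡n) w∈m))
    with refl ← +-cancelʳ-≡ k t t′ (trans t+k≡n (sym t′+k′≡n)) =
    ∈-filter⁺ (λ w → blanks w ≟ 0) w∈m (positive⇒blanks≡0 (All.map proj₁ ls))

  #𝔄≡finished : ∀ k t → t + k ≡ n → #𝔄 N k ≡ length (finished (even N) k t)
  #𝔄≡finished k t eq = unique-⊆⊇⇒length≡
    (Unique.filter⁺ _ (words-unique N N))
    (Unique.filter⁺ _ (marked-unique k t (even≤1 N) (≤-reflexive eq)))
    (𝔄⊆finished k t eq) (finished⊆𝔄 k t eq)

  -- Counting the finished words.

  length-finished : ∀ e ws → length (filter (λ w → blanks w ≟ 0) ws) ≡ sumOver (φ e 0 ∘ blanks) ws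
  length-finished e []       = refl
  length-finished e (w ∷ ws) with blanks w
  ... | zero  = cong suc (length-finished e ws)
  ... | suc _ = length-finished e ws

  -- Summing over the insertions into a word applies `transfer` to the test function, so going back
  -- t letters turns `φ e s` into `φ e (t + s)`.
  marked-sum : ∀ {e} k t s → e ≤ 1 → t + k ≤ n →
    sumOver (φ e s ∘ blanks) (marked e k t) ≡ sumOver (φ e (t + s) ∘ blanks) (marked e k 0)
  marked-sum     k zero    s _   _   = refl
  marked-sum {e} k (suc t) s e≤1 m<n =
    trans (sumOver-concatMap _ (insertions (t + k)) (marked e k t))
   (trans (sumOver-cong (marked e k t) λ {w} w∈ →
             trans (insertions-sum (φ e s) (t + k) w)
                   (cong (λ e′ → transfer e′ (φ e s) (blanks w)) (evenness (proj₁ (marked-sound k t e≤1 (<⇒≤ m<n) w∈)))))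
   (trans (marked-sum k t (suc s) e≤1 (<⇒≤ m<n))
          (cong (λ r → sumOver (φ e r ∘ blanks) (marked e k 0)) (+-suc t s))))

  -- The same descent through the letters that precede N; each of them raises the first index of `ψ`
  -- by one.
  unmarked-sum : ∀ {e} k s t → e ≤ 1 →
    sumOver (ψ e s t ∘ blanks) (unmarked e k) ≡ ψ e (k + s) t (blanks (start e))
  unmarked-sum     zero    s t _   = +-identityʳ _
  unmarked-sum {e} (suc k) s t e≤1 =
    trans (sumOver-concatMap _ (insertions k) (unmarked e k))
   (trans (sumOver-cong (unmarked e k) λ {w} w∈ →
             trans (insertions-sum (ψ e s t) k w)
                   (cong (λ e′ → transfer e′ (ψ e s t) (blanks w)) (evenness (unmarked-sound {m = k} e≤1 w∈))))
   (trans (unmarked-sum k (suc s) t e≤1)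
          (cong (λ r → ψ e r t (blanks (start e))) (+-suc k s))))

  -- `φ e 0` is the indicator of finished words. The t letters after `suc k` contribute T^t, the
  -- joint insertion of `suc k` and N contributes M, and the k smaller letters contribute T^k.
  #𝔄≡ψ : ∀ k t → t + suc k ≡ n → #𝔄 N (suc k) ≡ ψ (even N) k t (blanks (start (even N)))
  #𝔄≡ψ k t eq = begin
    #𝔄 N (suc k)                                       ≡⟨ #𝔄≡finished (suc k) t eq ⟩
    length (finished e (suc k) t)                      ≡⟨ length-finished e (marked e (suc k) t) ⟩
    sumOver (φ e 0 ∘ blanks) (marked e (suc k) t)      ≡⟨ marked-sum (suc k) t 0 e≤1 (≤-reflexive eq) ⟩
    sumOver (φ e (t + 0) ∘ blanks) (marked e (suc k) 0)
      ≡⟨ cong (λ t → sumOver (φ e t ∘ blanks) (marked e (suc k) 0)) (+-identityʳ t) ⟩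
    sumOver (φ e t ∘ blanks) (marked e (suc k) 0)      ≡⟨ sumOver-concatMap _ (markings k) (unmarked e k) ⟩
    sumOver (λ w → sumOver (φ e t ∘ blanks) (markings k w)) (unmarked e k)
      ≡⟨ sumOver-cong (unmarked e k) (λ {w} w∈ → trans (markings-sum (φ e t) k w)
           (cong (λ e′ → (blanks w + blanks w + e′) * φ e t (blanks w)) (evenness (unmarked-sound {m = k} e≤1 w∈)))) ⟩
    sumOver (ψ e 0 t ∘ blanks) (unmarked e k)          ≡⟨ unmarked-sum k 0 t e≤1 ⟩
    ψ e (k + 0) t (blanks (start e))                   ≡⟨ cong (λ k → ψ e k t (blanks (start e))) (+-identityʳ k) ⟩
    ψ e k t (blanks (start e))                         ∎
    where
    e = even N
    e≤1 = even≤1 N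

  -- The word consisting of N alone has no blank and admits no insertion; for even N there is not
  -- even this word.
  #𝔄0≡0 : ∀ t → t + 1 ≡ n → #𝔄 N 0 ≡ 0
  #𝔄0≡0 t eq = trans
    (#𝔄≡finished 0 (suc t) (trans (+-comm (suc t) 0) (trans (+-comm 1 t) eq)))
    (cong (length ∘ filter (λ w → blanks w ≟ 0)) (none (even N) t))
    where
    none : ∀ e t → marked e 0 (suc t) ≡ []
    none zero    zero    = refl
    none (suc e) zero    = refl
    none e       (suc t) = cong (concatMap (insertions (suc (t + 0)))) (none e t)

-- The difference system for the counts.

open Marked using (#𝔄≡ψ; #𝔄0≡0)
-- Passing from M to 2 + M preserves parity, so all four counts are values of `ψ` with the same `e`
-- at the same `c`.
#𝔄-difference : ∀ k t → let M = suc (t + suc k) in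
  #𝔄 (2 + M) (3 + k) + #𝔄 (2 + M) (1 + k) + 4 * #𝔄 M (1 + k) ≡ 2 * #𝔄 (2 + M) (2 + k)
#𝔄-difference k t = begin
  #𝔄 (2 + M) (3 + k) + #𝔄 (2 + M) (1 + k) + 4 * #𝔄 M (1 + k)
    ≡⟨ cong₂ _+_ (cong₂ _+_ (#𝔄≡ψ (1 + M) (2 + k) t (trans (+-suc t (2 + k)) (cong suc (+-suc t (suc k)))))
                            (#𝔄≡ψ (1 + M) k (2 + t) refl))
                 (cong (4 *_) (#𝔄≡ψ (t + suc k) k t refl)) ⟩
  ψ e (2 + k) t c + ψ e k (2 + t) c + 4 * ψ e k t c
    ≡⟨ ψ-difference e k t c ⟩
  2 * ψ e (1 + k) (1 + t) c
    ≡⟨ cong (2 *_) (#𝔄≡ψ (1 + M) (1 + k) (1 + t) (cong suc (+-suc t (suc k)))) ⟨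
  2 * #𝔄 (2 + M) (2 + k) ∎
  where
  M = suc (t + suc k)
  e = even M
  c = blanks (start e)

open import Data.Integer using (ℤ; +_; _-_) renaming (_+_ to _+ℤ_; _*_ to _*ℤ_)
open import Data.Integer.Properties using (pos-*; i≡j⇒i-j≡0)
import Data.Integer.Tactic.RingSolver as ℤ

difference-ℤ : ∀ x y z w → x + z + 4 * w ≡ 2 * y →
  (((+ x) - (+ 2) *ℤ (+ y)) +ℤ (+ z)) +ℤ (+ 4) *ℤ (+ w) ≡ + 0
difference-ℤ x y z w eq = begin
  (((+ x) - (+ 2) *ℤ (+ y)) +ℤ (+ z)) +ℤ (+ 4) *ℤ (+ w)  ≡⟨ lemma (+ x) (+ y) (+ z) (+ w) ⟩
  ((+ x) +ℤ (+ z) +ℤ (+ 4) *ℤ (+ w)) - (+ 2) *ℤ (+ y)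
    ≡⟨ cong₂ (λ u v → ((+ x) +ℤ (+ z) +ℤ u) - v) (sym (pos-* 4 w)) (sym (pos-* 2 y)) ⟩
  (+ (x + z + 4 * w)) - (+ (2 * y))                      ≡⟨ cong (λ u → (+ u) - (+ (2 * y))) eq ⟩
  (+ (2 * y)) - (+ (2 * y))                              ≡⟨ i≡j⇒i-j≡0 {+ (2 * y)} refl ⟩
  + 0                                                    ∎
  where
  lemma : ∀ x y z w → ((x - (+ 2) *ℤ y) +ℤ z) +ℤ (+ 4) *ℤ w ≡ (x +ℤ z +ℤ (+ 4) *ℤ w) - (+ 2) *ℤ y
  lemma = ℤ.solve-∀

#𝔄-difference-ℤ : ∀ M k → 1 ≤ k → k < M →
  (((+ #𝔄 (2 + M) (k + 2)) - (+ 2) *ℤ (+ #𝔄 (2 + M) (k + 1))) +ℤ (+ #𝔄 (2 + M) k)) +ℤ (+ 4) *ℤ (+ #𝔄 M k) ≡ + 0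
#𝔄-difference-ℤ (suc M) (suc k) _ (s≤s k<M)
  rewrite +-comm k 2 | +-comm k 1 =
  difference-ℤ (#𝔄 (3 + M) (3 + k)) (#𝔄 (3 + M) (2 + k)) (#𝔄 (3 + M) (1 + k)) (#𝔄 (1 + M) (1 + k))
    (subst (λ M → #𝔄 (3 + M) (3 + k) + #𝔄 (3 + M) (1 + k) + 4 * #𝔄 (1 + M) (1 + k) ≡ 2 * #𝔄 (3 + M) (2 + k))
      -- The argument `M ∸ suc k` is the number of letters strictly between `suc k` and the largest
      -- letter `1 + M`.
      (m∸n+n≡m k<M) (#𝔄-difference k (M ∸ suc k)))

-- Odd and even size: boundary values.

even-2* : ∀ m → even (2 * m) ≡ 1
even-2* zero    = refl
even-2* (suc m) = trans (cong even (*-suc 2 m)) (even-2* m)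

even-1+2* : ∀ m → even (1 + 2 * m) ≡ 0
even-1+2* zero    = refl
even-1+2* (suc m) = trans (cong (even ∘ suc) (*-suc 2 m)) (even-1+2* m)

2*[2+m] : ∀ m → 2 * (2 + m) ≡ 4 + 2 * m
2*[2+m] m = trans (*-suc 2 (suc m)) (cong (λ M → 2 + M) (*-suc 2 m))

#𝔄-odd : ∀ m k t → t + k ≡ 1 + 2 * m → #𝔄 (3 + 2 * m) (suc k) ≡ ψ 0 k t 1
#𝔄-odd m k t eq = trans (#𝔄≡ψ (2 + 2 * m) k t (trans (+-suc t k) (cong suc eq)))
                        (cong (λ e → ψ e k t (blanks (start e))) (even-1+2* m))

#𝔄-even : ∀ m k t → t + k ≡ 2 * m → #𝔄 (2 + 2 * m) (suc k) ≡ ψ 1 k t 0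
#𝔄-even m k t eq = trans (#𝔄≡ψ (1 + 2 * m) k t (trans (+-suc t k) (cong suc eq)))
                         (cong (λ e → ψ e k t (blanks (start e))) (even-2* m))

-- For e = 0 the factor M is 2c, which annihilates the indicator of 0.
ψ-last-odd : ∀ s c → ψ 0 s 0 c ≡ 0
ψ-last-odd zero    zero    = refl
ψ-last-odd zero    (suc c) = *-zeroʳ (suc c + suc c + 0)
ψ-last-odd (suc s) c       = trans (transfer-cong 0 (ψ-last-odd s) c) (cong₂ _+_ (*-zeroʳ c) (*-zeroʳ (c + 0)))

-- For e = 1 the factor 2c + 1 is 1 at c = 0, so M fixes the indicator of 0.
ψ-last-even : ∀ s c → ψ 1 s 0 c ≡ φ 1 s c
ψ-last-even zero    zero    = refl
ψ-last-even zero    (suc c) = *-zeroʳ (suc c + suc c + 1)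
ψ-last-even (suc s) c       = transfer-cong 1 (ψ-last-even s) c

sum-applyUpTo-cong : ∀ {f g : ℕ → ℕ} m → (∀ {i} → i < m → f i ≡ g i) → sum (applyUpTo f m) ≡ sum (applyUpTo g m)
sum-applyUpTo-cong zero    _  = refl
sum-applyUpTo-cong (suc m) eq = cong₂ _+_ (eq z<s) (sum-applyUpTo-cong m (eq ∘ s<s))

-- The sum telescopes by `ψ-sum`; the result is the common value of both boundary terms for the next
-- n.
#𝔄-even-total : ∀ m → sum1to (1 + 2 * m) (#𝔄 (2 + 2 * m)) ≡ φ 1 (2 + 2 * m) 0
#𝔄-even-total m = begin
  sum (applyUpTo (λ i → #𝔄 (2 + 2 * m) (suc i)) (1 + 2 * m))
    ≡⟨ sum-applyUpTo-cong (1 + 2 * m) (λ { {i} (s≤s i≤) → #𝔄-even m i (2 * m ∸ i) (m∸n+n≡m i≤) }) ⟩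
  sum (applyUpTo (λ i → ψ 1 i (2 * m ∸ i) 0) (1 + 2 * m))      ≡⟨ +-identityʳ _ ⟨
  -- The added 0 is the correction term of `ψ-sum`, whose factor c is 0 here.
  sum (applyUpTo (λ i → ψ 1 i (2 * m ∸ i) 0) (1 + 2 * m)) + 0  ≡⟨ ψ-sum 1 (2 * m) 0 ⟩
  φ 1 (2 + 2 * m) 0 ∎

aₙ-first : ∀ m → #𝔄 (3 + 2 * m) 0 ≡ 0
aₙ-first m = #𝔄0≡0 (2 + 2 * m) (1 + 2 * m) (+-comm (1 + 2 * m) 1)

-- For e = 0 a word without blanks admits no insertion, so the values at 0 vanish and both sides
-- become `4 * φ 0 (suc t) 2`.
ψ-first-odd : ∀ t → ψ 0 1 (suc t) 1 + 0 + 4 * 0 ≡ 2 * ψ 0 0 (2 + t) 1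
ψ-first-odd t = lemma (φ 0 (suc t) 2)
  where
  lemma : ∀ x → 1 * 0 + (1 + 0) * (4 * x) + 0 + 4 * 0 ≡ 2 * (2 * (1 * 0 + (1 + 0) * x))
  lemma = solve-∀

-- For k = 1 the index of #𝔄 is 0, i.e. N has no neighbour, and ψ does not apply.
aₙ-difference₁ : ∀ m → #𝔄 (3 + 2 * m) 2 + #𝔄 (3 + 2 * m) 0 + 4 * #𝔄 (1 + 2 * m) 0 ≡ 2 * #𝔄 (3 + 2 * m) 1
-- For the sizes 3 and 1 the permutation of a single letter contributes to index 0; this case is
-- evaluated.
aₙ-difference₁ zero    = refl
aₙ-difference₁ (suc m) = begin
  #𝔄 (3 + j) 2 + #𝔄 (3 + j) 0 + 4 * #𝔄 (1 + j) 0
    ≡⟨ cong₂ _+_ (cong₂ _+_ (#𝔄-odd (suc m) 1 j (+-comm j 1)) (aₙ-first (suc m)))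
                 (cong (4 *_) (trans (cong (λ M → #𝔄 (1 + M) 0) (*-suc 2 m)) (aₙ-first m))) ⟩
  ψ 0 1 j 1 + 0 + 4 * 0
    ≡⟨ cong (λ t → ψ 0 1 t 1 + 0 + 4 * 0) (*-suc 2 m) ⟩
  ψ 0 1 (2 + 2 * m) 1 + 0 + 4 * 0
    ≡⟨ ψ-first-odd (1 + 2 * m) ⟩
  2 * ψ 0 0 (3 + 2 * m) 1
    ≡⟨ cong (λ t → 2 * ψ 0 0 (1 + t) 1) (*-suc 2 m) ⟨
  2 * ψ 0 0 (1 + j) 1
    ≡⟨ cong (2 *_) (#𝔄-odd (suc m) 0 (1 + j) (+-identityʳ (1 + j))) ⟨
  2 * #𝔄 (3 + j) 1 ∎
  where
  j = 2 * suc m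

-- The system and initial values for both families.

Difference : (ℕ → ℕ) → (ℕ → ℕ) → ℕ → Set
Difference f g k = (((+ f (k + 2)) - (+ 2) *ℤ (+ f (k + 1))) +ℤ (+ f k)) +ℤ (+ 4) *ℤ (+ g k) ≡ + 0

aₙ-difference : ∀ n k → 2 ≤ n → 1 ≤ k → k ≤ 2 * n ∸ 3 → Difference (aₙ n) (aₙ (n ∸ 1)) k
-- Once `2 * (2 + m)` has the form `4 + 2 * m`, the truncated subtractions compute.
aₙ-difference (suc (suc m)) (suc k) _ _ k≤ = subst₂ (λ M M′ →
    Difference (λ k → #𝔄 (M ∸ 1) (k ∸ 1)) (λ k → #𝔄 (M′ ∸ 1) (k ∸ 1)) (suc k))
    (sym (2*[2+m] m)) (sym (*-suc 2 m))
    (go k (subst (λ M → suc k ≤ M ∸ 3) (2*[2+m] m) k≤))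
  where
  go : ∀ k → k < 1 + 2 * m → Difference (λ k → #𝔄 (3 + 2 * m) (k ∸ 1)) (λ k → #𝔄 (1 + 2 * m) (k ∸ 1)) (suc k)
  go zero    _  = difference-ℤ (#𝔄 (3 + 2 * m) 2) (#𝔄 (3 + 2 * m) 1) (#𝔄 (3 + 2 * m) 0) (#𝔄 (1 + 2 * m) 0)
                               (aₙ-difference₁ m)
  go (suc k) k< = #𝔄-difference-ℤ (1 + 2 * m) (suc k) z<s k<

bₙ-difference : ∀ n k → 2 ≤ n → 1 ≤ k → k ≤ 2 * n ∸ 3 → Difference (bₙ n) (bₙ (n ∸ 1)) k
bₙ-difference (suc zero) _ (s≤s ()) _ _
bₙ-difference (suc (suc m)) k _ 1≤k k≤ = subst₂ (λ M M′ → Difference (#𝔄 M) (#𝔄 M′) k)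
    (sym (2*[2+m] m)) (sym (*-suc 2 m))
    (#𝔄-difference-ℤ (2 + 2 * m) k 1≤k (s≤s (subst (λ M → k ≤ M ∸ 3) (2*[2+m] m) k≤)))

aₙ-boundary : ∀ n → 2 ≤ n → aₙ n 1 ≡ 0 × aₙ n (2 * n ∸ 1) ≡ 0
aₙ-boundary (suc zero) (s≤s ())
aₙ-boundary (suc (suc m)) _ = subst (λ M → #𝔄 (M ∸ 1) 0 ≡ 0 × #𝔄 (M ∸ 1) (M ∸ 1 ∸ 1) ≡ 0) (sym (2*[2+m] m))
  (aₙ-first m , trans (#𝔄-odd m (1 + 2 * m) 0 refl) (ψ-last-odd (1 + 2 * m) 1))

bₙ-boundary : ∀ n → 2 ≤ n →
  bₙ n 1 ≡ sum1to (2 * (n ∸ 1) ∸ 1) (bₙ (n ∸ 1)) × bₙ n (2 * n ∸ 1) ≡ sum1to (2 * (n ∸ 1) ∸ 1) (bₙ (n ∸ 1))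
bₙ-boundary (suc zero) (s≤s ())
bₙ-boundary (suc (suc m)) _ = subst₂ (λ M M′ →
    #𝔄 M 1 ≡ sum1to (M′ ∸ 1) (#𝔄 M′) × #𝔄 M (M ∸ 1) ≡ sum1to (M′ ∸ 1) (#𝔄 M′))
    (sym (2*[2+m] m)) (sym (*-suc 2 m))
    -- At the first index M acts last, with factor 1 at c = 0; at the last index it acts first and
    -- fixes the indicator of 0. Both values are thus `φ 1 (2 + 2 * m) 0`.
    ( trans (#𝔄-even′ 0 (2 + 2 * m) (+-identityʳ (2 + 2 * m)))
        (trans (+-identityʳ (φ 1 (2 + 2 * m) 0)) (sym (#𝔄-even-total m)))
    , trans (#𝔄-even′ (2 + 2 * m) 0 refl)
        (trans (ψ-last-even (2 + 2 * m) 0) (sym (#𝔄-even-total m))) )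
  where
  #𝔄-even′ : ∀ k t → t + k ≡ 2 + 2 * m → #𝔄 (4 + 2 * m) (suc k) ≡ ψ 1 k t 0
  #𝔄-even′ k t eq = trans (cong (λ M → #𝔄 (2 + M) (suc k)) (sym (*-suc 2 m)))
                          (#𝔄-even (suc m) k t (trans eq (sym (*-suc 2 m))))

theorem1p5 : (∀ n k → 2 ≤ n → 1 ≤ k → k ≤ 2 * n ∸ 3 →
    (((+ aₙ n (k + 2)) - (+ 2) *ℤ (+ aₙ n (k + 1))) +ℤ (+ aₙ n k)) +ℤ (+ 4) *ℤ (+ aₙ (n ∸ 1) k) ≡ + 0)
    × aₙ 1 1 ≡ 1
    × (∀ n → 2 ≤ n → aₙ n 1 ≡ 0 × aₙ n (2 * n ∸ 1) ≡ 0)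
    × (∀ n k → 2 ≤ n → 1 ≤ k → k ≤ 2 * n ∸ 3 →
    (((+ bₙ n (k + 2)) - (+ 2) *ℤ (+ bₙ n (k + 1))) +ℤ (+ bₙ n k)) +ℤ (+ 4) *ℤ (+ bₙ (n ∸ 1) k) ≡ + 0)
    × bₙ 1 1 ≡ 1
    × (∀ n → 2 ≤ n →
    bₙ n 1 ≡ sum1to (2 * (n ∸ 1) ∸ 1) (bₙ (n ∸ 1))
    × bₙ n (2 * n ∸ 1) ≡ sum1to (2 * (n ∸ 1) ∸ 1) (bₙ (n ∸ 1)))
theorem1p5 = aₙ-difference , refl , aₙ-boundary , bₙ-difference , refl , bₙ-boundary
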